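{- For all integers $m \geq 1$, $k \geq 1$, and $n$ with $\max(2, k - m + 2) \leq n \leq k$, \[|\mathrm{ParseWords}(\mathrm{LeftTurnTree}(m, n), \mathrm{RightTurnTree}(k, m + n - k))| = 1.\]
   Context: A binary tree is a rooted ordered tree in which each vertex has either $0$ or $2$ children; its leaves are ordered left to right. Let $G$ be the context-free grammar with start symbols $0,1,2$ and rules $0\to 12$, $0\to 21$, $1\to 02$, $1\to 20$, $2\to 01$, $2\to 10$. An $n$-leaf binary tree $T$ parses a word $w$ of length $n$ on $\{0,1,2\}$ if there is a labeling of the vertices of $T$ by $0,1,2$ such that the leaves, from left to right, are labeled with the letters of $w$, and at every internal vertex the label of the vertex together with the labels of its left and right children form a rule of $G$ (i.e. the three labels are pairwise distinct). If $T$ parses $w$, it also parses every word obtained from $w$ by permuting the alphabet $\{0,1,2\}$. For binary trees $T_1,T_2$ with the same number of leaves, $\mathrm{ParseWords}(T_1,T_2)$ denotes the set of equivalence classes (under permutations of the alphabet $\{0,1,2\}$) of words parsed by both $T_1$ and $T_2$. The level of a vertex is its distance from the root. A path tree is a binary tree with at most two vertices on each level. For $N\ge 2$, $N$-leaf path trees correspond bijectively to words $x_1\cdots x_{N-2}$ on $\{l,r\}$: $x_j=l$ (resp. $x_j=r$) means that, of the two vertices on level $j$, the left (resp. right) one has children. $\mathrm{LeftTurnTree}(p,q)$ is the $(p+q)$-leaf path tree corresponding to $l^p r^{q-2}$, and $\mathrm{RightTurnTree}(p,q)$ is the $(p+q)$-leaf path tree corresponding to $r^p l^{q-2}$. -}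

module Defs where

open import Data.Fin using (Fin)
open import Data.Fin.Patterns using (0F; 1F; 2F)
open import Data.Fin.Permutation as Perm using (Permutation′; _⟨$⟩ʳ_)
open import Data.List using (List; []; _∷_; _++_; map; replicate)
open import Data.List.Properties using (map-id; map-cong; map-∘)
open import Data.Nat using (ℕ; _∸_)
open import Data.Product using (Σ; ∃; _×_; _,_; proj₁)
open import Data.Tree.Binary as Tree using (Tree; leaf; node; module Leaves)
open import Data.Unit using (⊤; tt)
open import Function using (const)
open import Function.Bundles using (Inverse)
open import Level using (0ℓ)
open import Relation.Binary.Bundles using (Setoid)
open import Relation.Binary.Definitions using (Reflexive; Symmetric; Transitive)
open import Relation.Binary.PropositionalEquality
  using (_≡_; refl; sym; trans; cong)
import Relation.Binary.PropositionalEquality as ≡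

BinaryTree : Set
BinaryTree = Tree ⊤ ⊤

Letter : Set
Letter = Fin 3

Word : Set
Word = List Letter

infix 4 _⟶_∙_

data _⟶_∙_ : Letter → Letter → Letter → Set where
  0⟶12 : 0F ⟶ 1F ∙ 2F
  0⟶21 : 0F ⟶ 2F ∙ 1F
  1⟶02 : 1F ⟶ 0F ∙ 2F
  1⟶20 : 1F ⟶ 2F ∙ 0F
  2⟶01 : 2F ⟶ 0F ∙ 1F
  2⟶10 : 2F ⟶ 1F ∙ 0F

LabelledTree : Set
LabelledTree = Tree Letter Letter

shape : LabelledTree → BinaryTree
shape = Tree.map (const tt) (const tt)

rootLabel : LabelledTree → Letter
rootLabel (leaf a)     = a
rootLabel (node _ a _) = a

Valid : LabelledTree → Set
Valid (leaf _)     = ⊤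
Valid (node s a t) = (a ⟶ rootLabel s ∙ rootLabel t) × Valid s × Valid t

infix 4 _parses_

-- No length condition on w is needed: hasShape and yield force its length to be
-- the number of leaves of T.
record _parses_ (T : BinaryTree) (w : Word) : Set where
  field
    labelling : LabelledTree
    hasShape  : shape labelling ≡ T
    valid     : Valid labelling
    yield     : Leaves.toList labelling ≡ w

infix 4 _∼_

_∼_ : Word → Word → Set
v ∼ w = ∃ λ (π : Permutation′ 3) → map (π ⟨$⟩ʳ_) v ≡ w

∼-refl : Reflexive _∼_
∼-refl {w} = Perm.id , map-id w

∼-sym : Symmetric _∼_
∼-sym {v} (π , refl) = Perm.flip π ,
  trans (sym (map-∘ v)) (trans (map-cong (λ _ → Perm.inverseˡ π) v) (map-id v))

∼-trans : Transitive _∼_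
∼-trans {u} (π , refl) (ρ , refl) = π Perm.∘ₚ ρ , map-∘ u

-- The quotient set of the words parsed by both trees, as a setoid: its
-- equality ignores the parses and identifies words up to permuting letters.
ParseWords : BinaryTree → BinaryTree → Setoid 0ℓ 0ℓ
ParseWords T₁ T₂ = record
  { Carrier       = Σ Word λ w → T₁ parses w × T₂ parses w
  ; _≈_           = λ v w → proj₁ v ∼ proj₁ w
  ; isEquivalence = record { refl = ∼-refl ; sym = ∼-sym ; trans = ∼-trans }
  }

-- ∣ S ∣≡ n: the setoid S has exactly n equivalence classes.
∣_∣≡_ : Setoid 0ℓ 0ℓ → ℕ → Set
∣ S ∣≡ n = Inverse S (≡.setoid (Fin n))

data Direction : Set where
  l r : Direction

-- The root always has children; the j-th letter says which of the two
-- vertices on level j has children, so x₁ ⋯ x_{N-2} gives N leaves.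
pathTree : List Direction → BinaryTree
pathTree []      = node (leaf tt) tt (leaf tt)
pathTree (l ∷ x) = node (pathTree x) tt (leaf tt)
pathTree (r ∷ x) = node (leaf tt) tt (pathTree x)

-- The two definitions below are meaningful for q ≥ 2 only (∸ truncates).
LeftTurnTree : ℕ → ℕ → BinaryTree
LeftTurnTree p q = pathTree (replicate p l ++ replicate (q ∸ 2) r)

RightTurnTree : ℕ → ℕ → BinaryTree
RightTurnTree p q = pathTree (replicate p r ++ replicate (q ∸ 2) l)

{-# OPTIONS --safe #-}

-- Read the letters as the nonzero elements of the Klein four-group.  Then
-- a ⟶ b ∙ c says that b ≠ c and a = b + c, so the labels along a path tree are
-- determined step by step by the leaves read along it.  If two paths carry
-- labels a ≠ a′ and read the same leaf x, then x ∉ {a , a′}, so x = a + a′ and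
-- the two labels are exchanged.  The two trees provide such a pair of paths on
-- each of three consecutive stretches of the word, which is therefore
-- determined by the label b at the turn of LeftTurnTree, the root label c and
-- d = b + c.  Permutations of the alphabet act simply transitively on the
-- triples (b , c , d).
module Submission where

open import Defs
open import Data.Fin.Patterns using (0F; 1F; 2F)
open import Data.Fin.Permutation as Perm using (Permutation′; _⟨$⟩ʳ_; _∘ₚ_; transpose)
open import Data.List using (List; []; _∷_; [_]; _++_; map; replicate)
open import Data.List.Properties using (++-assoc; ++-identityʳ; map-++; map-replicate)
open import Data.Nat using (ℕ; zero; suc; _+_; _∸_; _⊔_; _≤_)
open import Data.Nat.Properties
open import Data.Product using (∃; ∃₂; _×_; _,_)
open import Data.Tree.Binary using (leaf; node; module Leaves)
open import Data.Unit using (tt)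
open import Relation.Binary.PropositionalEquality
  using (_≡_; refl; sym; trans; cong; cong₂; subst; subst₂; module ≡-Reasoning)

private variable
  A B               : Set
  i j n             : ℕ
  a a′ b b′ c d t x : Letter
  u v w             : Word
  S T               : BinaryTree

-- Symmetries of the rules

rotate : a ⟶ b ∙ c → b ⟶ c ∙ a
rotate 0⟶12 = 1⟶20
rotate 0⟶21 = 2⟶10
rotate 1⟶02 = 0⟶21
rotate 1⟶20 = 2⟶01
rotate 2⟶01 = 0⟶12
rotate 2⟶10 = 1⟶02

-- Together with `rotate` this generates all six orderings of a triple of distinct letters; later
-- compositions of the two only reorder a rule.
swap : a ⟶ b ∙ c → a ⟶ c ∙ b
swap 0⟶12 = 0⟶21
swap 0⟶21 = 0⟶12
swap 1⟶02 = 1⟶20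
swap 1⟶20 = 1⟶02
swap 2⟶01 = 2⟶10
swap 2⟶10 = 2⟶01

child-unique : a ⟶ b ∙ c → a ⟶ b ∙ d → c ≡ d
child-unique 0⟶12 0⟶12 = refl
child-unique 0⟶21 0⟶21 = refl
child-unique 1⟶02 1⟶02 = refl
child-unique 1⟶20 1⟶20 = refl
child-unique 2⟶01 2⟶01 = refl
child-unique 2⟶10 2⟶10 = refl

steps-exchange : t ⟶ a ∙ a′ → a ⟶ x ∙ b → a′ ⟶ x ∙ b′ →
                 x ≡ t × b ≡ a′ × b′ ≡ a
steps-exchange 0⟶12 1⟶02 2⟶01 = refl , refl , refl
steps-exchange 0⟶12 1⟶20 ()
steps-exchange 0⟶21 2⟶01 1⟶02 = refl , refl , refl
steps-exchange 0⟶21 2⟶10 ()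
steps-exchange 1⟶02 0⟶12 2⟶10 = refl , refl , refl
steps-exchange 1⟶02 0⟶21 ()
steps-exchange 1⟶20 2⟶10 0⟶12 = refl , refl , refl
steps-exchange 1⟶20 2⟶01 ()
steps-exchange 2⟶01 0⟶21 1⟶20 = refl , refl , refl
steps-exchange 2⟶01 0⟶12 ()
steps-exchange 2⟶10 1⟶20 0⟶21 = refl , refl , refl
steps-exchange 2⟶10 1⟶02 ()

permutationTo : d ⟶ b ∙ c →
  ∃ λ (π : Permutation′ 3) → π ⟨$⟩ʳ 0F ≡ b × π ⟨$⟩ʳ 1F ≡ c × π ⟨$⟩ʳ 2F ≡ d
permutationTo 0⟶12 = transpose 0F 1F ∘ₚ transpose 0F 2F , refl , refl , refl
permutationTo 0⟶21 = transpose 0F 2F , refl , refl , refl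
permutationTo 1⟶02 = transpose 1F 2F , refl , refl , refl
permutationTo 1⟶20 = transpose 0F 2F ∘ₚ transpose 0F 1F , refl , refl , refl
permutationTo 2⟶01 = Perm.id , refl , refl , refl
permutationTo 2⟶10 = transpose 0F 1F , refl , refl , refl

-- Alternating labels and runs along a path

alternate : ℕ → A → A → A
alternate zero    x y = x
alternate (suc n) x y = alternate n y x

-- On the pair of its arguments, `alternate n` acts as the n-th power of the exchange, whose square
-- is the identity.
alternate-involutive : ∀ n (x y : A) →
                       alternate n (alternate n x y) (alternate n y x) ≡ x
alternate-involutive zero    x y = refl
alternate-involutive (suc n) x y = alternate-involutive n x y

alternate-natural : ∀ (f : A → B) n x y →
                    f (alternate n x y) ≡ alternate n (f x) (f y)
alternate-natural f zero    x y = refl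
alternate-natural f (suc n) x y = alternate-natural f n y x

alternate-⟶ : ∀ n → t ⟶ a ∙ b → t ⟶ alternate n a b ∙ alternate n b a
alternate-⟶ zero    ρ = ρ
alternate-⟶ (suc n) ρ = alternate-⟶ n (swap ρ)

-- Since the three letters of a rule may be permuted freely, a run describes
-- both a descent to the right and an ascent from the left.
data Run : ℕ → Letter → Word → Letter → Set where
  []  : Run zero a [] a
  _∷_ : a ⟶ x ∙ b → Run n b w c → Run (suc n) a (x ∷ w) c

run-++ : Run i a u b → Run j b v c → Run (i + j) a (u ++ v) c
run-++ []      S = S
run-++ (ρ ∷ R) S = ρ ∷ run-++ R S

run-split : ∀ i → Run (i + j) a w c →
            ∃₂ λ u v → ∃ λ b → w ≡ u ++ v × Run i a u b × Run j b v c
run-split zero    R       = _ , _ , _ , refl , [] , R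
run-split (suc i) (ρ ∷ R) with run-split i R
... | _ , _ , _ , refl , R₁ , R₂ = _ , _ , _ , refl , ρ ∷ R₁ , R₂

alternatingRun : ∀ n → t ⟶ a ∙ b → Run n a (replicate n t) (alternate n a b)
alternatingRun zero    ρ = []
alternatingRun (suc n) ρ = swap (rotate ρ) ∷ alternatingRun n (swap ρ)

-- Each shared leaf exchanges the two labels and keeps their sum `t`, so `swap ρ` serves the
-- remaining leaves.
runs-alternate : t ⟶ a ∙ a′ → Run n a w b → Run n a′ w b′ →
  w ≡ replicate n t × b ≡ alternate n a a′ × b′ ≡ alternate n a′ a
runs-alternate ρ []      []       = refl , refl , refl
runs-alternate ρ (σ ∷ R) (σ′ ∷ R′) with steps-exchange ρ σ σ′
... | refl , refl , refl with runs-alternate (swap ρ) R R′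
... | refl , refl , refl = refl , refl , refl

-- A shared leaf is added to both labels, so their sum is invariant and can be carried from the ends
-- back to the starts. Each step is reversed before `steps-exchange` applies.
difference-backwards : t ⟶ b ∙ b′ → Run n a w b → Run n a′ w b′ → t ⟶ a ∙ a′
difference-backwards ρ []      []        = ρ
difference-backwards ρ (σ ∷ R) (σ′ ∷ R′)
  with ρ₁ ← difference-backwards ρ R R′
  with steps-exchange ρ₁ (swap (rotate (rotate σ))) (swap (rotate (rotate σ′)))
... | refl , refl , refl = swap ρ₁

-- Derivations in place of labelled trees

data _⊢_⇒_ : BinaryTree → Letter → Word → Set where
  leaf : leaf tt ⊢ a ⇒ [ a ]
  -- The concatenation is kept as an equation so that matching need not unify `++`.
  node : a ⟶ b ∙ c → S ⊢ b ⇒ u → T ⊢ c ⇒ v → w ≡ u ++ v →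
         node S tt T ⊢ a ⇒ w

toDiffList-++ : ∀ (t : LabelledTree) v →
                Leaves.toDiffList t v ≡ Leaves.toList t ++ v
toDiffList-++ (leaf x)      v = refl
toDiffList-++ (node t₁ _ t₂) v = begin
  D t₁ (D t₂ v)             ≡⟨ toDiffList-++ t₁ _ ⟩
  L t₁ ++ D t₂ v            ≡⟨ cong (L t₁ ++_) (toDiffList-++ t₂ v) ⟩
  L t₁ ++ (L t₂ ++ v)       ≡⟨ ++-assoc (L t₁) (L t₂) v ⟨
  (L t₁ ++ L t₂) ++ v       ≡⟨ cong (_++ v) (toDiffList-++ t₁ (L t₂)) ⟨
  D t₁ (L t₂) ++ v          ∎
  where
  open ≡-Reasoning
  D = Leaves.toDiffList
  L = Leaves.toList

derivation : ∀ t → Valid t → shape t ⊢ rootLabel t ⇒ Leaves.toList t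
derivation (leaf x)       _            = leaf
derivation (node t₁ _ t₂) (ρ , v₁ , v₂) =
  node ρ (derivation t₁ v₁) (derivation t₂ v₂) (toDiffList-++ t₁ _)

parses⇒derives : T parses w → ∃ λ a → T ⊢ a ⇒ w
parses⇒derives record { labelling = t ; hasShape = refl ; valid = v ; yield = refl } =
  _ , derivation t v

labelled : T ⊢ a ⇒ w → ∃ λ t →
           shape t ≡ T × rootLabel t ≡ a × Valid t × Leaves.toList t ≡ w
labelled leaf = leaf _ , refl , refl , tt , refl
labelled (node {a = a} ρ D₁ D₂ refl) with labelled D₁ | labelled D₂
... | t₁ , refl , refl , v₁ , refl | t₂ , refl , refl , v₂ , refl =
  node t₁ a t₂ , refl , refl , (ρ , v₁ , v₂) , toDiffList-++ t₁ _

derives⇒parses : T ⊢ a ⇒ w → T parses w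
derives⇒parses D with labelled D
... | t , s , _ , v , y = record { labelling = t ; hasShape = s ; valid = v ; yield = y }

-- Path trees as spines

leftSpine : ℕ → BinaryTree → BinaryTree
leftSpine zero    T = T
leftSpine (suc n) T = leftSpine n (node T tt (leaf tt))

rightSpine : ℕ → BinaryTree → BinaryTree
rightSpine zero    T = T
rightSpine (suc n) T = node (leaf tt) tt (rightSpine n T)

-- `leftSpine` adds vertices from the bottom, in the order in which an ascending run reads its
-- leaves, whereas `pathTree` starts at the root.
leftSpine-node : ∀ n → leftSpine n (node T tt (leaf tt)) ≡ node (leftSpine n T) tt (leaf tt)
leftSpine-node zero    = refl
leftSpine-node (suc n) = leftSpine-node n

pathTree-l : ∀ n x → pathTree (replicate n l ++ x) ≡ leftSpine n (pathTree x)
pathTree-l zero    x = refl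
pathTree-l (suc n) x =
  trans (cong (λ T → node T tt (leaf tt)) (pathTree-l n x)) (sym (leftSpine-node n))

pathTree-r : ∀ n x → pathTree (replicate n r ++ x) ≡ rightSpine n (pathTree x)
pathTree-r zero    x = refl
pathTree-r (suc n) x = cong (node (leaf tt) tt) (pathTree-r n x)

-- The empty path already has a root with two leaves, a spine of length one; hence the `suc`.
pathTree-ls : ∀ n → pathTree (replicate n l) ≡ leftSpine (suc n) (leaf tt)
pathTree-ls n = trans (cong pathTree (sym (++-identityʳ _))) (pathTree-l n [])

pathTree-rs : ∀ n → pathTree (replicate n r) ≡ rightSpine (suc n) (leaf tt)
pathTree-rs zero    = refl
pathTree-rs (suc n) = cong (node (leaf tt) tt) (pathTree-rs n)

leftSpine-derives : T ⊢ a ⇒ u → Run n a v b → leftSpine n T ⊢ b ⇒ (u ++ v)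
leftSpine-derives D []      = subst (_ ⊢ _ ⇒_) (sym (++-identityʳ _)) D
leftSpine-derives {u = u} D (ρ ∷ R) =
  subst (_ ⊢ _ ⇒_) (++-assoc u _ _)
    (leftSpine-derives (node (rotate (rotate ρ)) D leaf refl) R)

rightSpine-+ : ∀ i j → rightSpine (i + j) T ≡ rightSpine i (rightSpine j T)
rightSpine-+ zero    j = refl
rightSpine-+ (suc i) j = cong (node (leaf tt) tt) (rightSpine-+ i j)

rightSpine-derives : Run n a u b → T ⊢ b ⇒ v → rightSpine n T ⊢ a ⇒ (u ++ v)
rightSpine-derives []      D = D
rightSpine-derives (ρ ∷ R) D = node ρ leaf (rightSpine-derives R D) refl

leftSpine-run : ∀ n → leftSpine n T ⊢ b ⇒ w →
  ∃₂ λ u v → ∃ λ a → w ≡ u ++ v × T ⊢ a ⇒ u × Run n a v b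
leftSpine-run zero    D = _ , [] , _ , sym (++-identityʳ _) , D , []
leftSpine-run (suc n) D with leftSpine-run n D
... | _ , v , _ , refl , node {u = u} ρ D₁ leaf refl , R =
  u , _ , _ , ++-assoc u _ v , D₁ , rotate ρ ∷ R

rightSpine-run : ∀ n → rightSpine n T ⊢ a ⇒ w →
  ∃₂ λ u v → ∃ λ b → w ≡ u ++ v × Run n a u b × T ⊢ b ⇒ v
rightSpine-run zero    D = _ , _ , _ , refl , [] , D
rightSpine-run (suc n) (node ρ leaf D refl) with rightSpine-run n D
... | _ , _ , _ , refl , R , D₁ = _ , _ , _ , refl , ρ ∷ R , D₁

-- The run from the other tree fixes the length of `u`, so this tree is cut at the same place and
-- both runs read the same leaves.
rightSpine-along : Run n a′ u b′ → rightSpine n T ⊢ a ⇒ (u ++ v) →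
  ∃ λ b → Run n a u b × T ⊢ b ⇒ v
rightSpine-along []      D = _ , [] , D
rightSpine-along (_ ∷ R) (node ρ leaf D refl) with rightSpine-along R D
... | _ , R′ , D′ = _ , ρ ∷ R′ , D′

-- A word parsed by both trees

LeftTurn RightTurn : ℕ → ℕ → ℕ → BinaryTree
LeftTurn  i j h = leftSpine (j + suc h) (rightSpine i (leaf tt))
RightTurn i j h = rightSpine i (rightSpine (suc j) (leftSpine h (leaf tt)))

-- The two single letters separating the three stretches sit at the bottom leaf of `LeftTurn` and at
-- that of `RightTurn`, respectively.
commonWord : ℕ → ℕ → ℕ → A → A → A → List A
commonWord i j h b c d =
  replicate i d ++ alternate i b c ∷
  replicate j c ++ alternate h (alternate j d b) c ∷
  replicate h (alternate j b d)

map-commonWord : ∀ (f : A → B) i j h b c d →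
  map f (commonWord i j h b c d) ≡ commonWord i j h (f b) (f c) (f d)
map-commonWord f i j h b c d = begin
  map f (commonWord i j h b c d)
    ≡⟨ map-++ f (replicate i d) _ ⟩
  map f (replicate i d) ++ f (alternate i b c) ∷ map f (replicate j c ++ _)
    ≡⟨ cong₂ _++_ (map-replicate f i d)
         (cong₂ _∷_ (alternate-natural f i b c) (map-++ f (replicate j c) _)) ⟩
  replicate i (f d) ++ alternate i (f b) (f c) ∷
  map f (replicate j c) ++ f (alternate h (alternate j d b) c) ∷ map f (replicate h _)
    ≡⟨ cong (λ z → replicate i (f d) ++ alternate i (f b) (f c) ∷ z)
         (cong₂ _++_ (map-replicate f j c) (cong₂ _∷_
           (trans (alternate-natural f h _ c)
             (cong (λ z → alternate h z (f c)) (alternate-natural f j d b)))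
           (trans (map-replicate f h _)
             (cong (replicate h) (alternate-natural f j b d))))) ⟩
  commonWord i j h (f b) (f c) (f d) ∎
  where open ≡-Reasoning

leftTurn-derives : ∀ i j h → d ⟶ b ∙ c → LeftTurn i j h ⊢ c ⇒ commonWord i j h b c d
leftTurn-derives {d} {b} {c} i j h ρ =
  subst (_ ⊢ c ⇒_) (++-assoc (replicate i d) _ _)
    (leftSpine-derives (rightSpine-derives (alternatingRun i ρ) leaf)
      (run-++ (alternatingRun j c⟶bd) (p⟶zp′ ∷ ascent)))
  where
  -- After the middle stretch the label is `p` in `LeftTurn` and `q` in `RightTurn`.
  q = alternate j d b
  p = alternate j b d
  c⟶bd = rotate (swap ρ)
  p⟶qc = rotate (alternate-⟶ j c⟶bd)
  p⟶zp′ = alternate-⟶ h p⟶qc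
  -- The start is chosen so that h exchanges lead to the root label `c`.
  ascent : Run h (alternate h c q) (replicate h p) c
  ascent = subst (Run h _ _) (alternate-involutive h c q) (alternatingRun h (swap p⟶zp′))

rightTurn-derives : ∀ i j h → d ⟶ b ∙ c → RightTurn i j h ⊢ c ⇒ commonWord i j h b c d
rightTurn-derives {d} {b} {c} i j h ρ =
  rightSpine-derives (alternatingRun i (swap ρ))
    (rightSpine-derives
      (rotate (swap (alternate-⟶ i ρ)) ∷ alternatingRun j (swap c⟶bd))
      (leftSpine-derives leaf ascent))
  where
  q = alternate j d b
  p = alternate j b d
  c⟶bd = rotate (swap ρ)
  p⟶qc = rotate (alternate-⟶ j c⟶bd)
  ascent : Run h (alternate h q c) (replicate h p) q
  ascent = subst (Run h _ _) (alternate-involutive h q c)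
             (alternatingRun h (alternate-⟶ h p⟶qc))

-- Uniqueness of the common word

derives-unique : ∀ i j h → LeftTurn i j h ⊢ a ⇒ w → RightTurn i j h ⊢ c ⇒ w →
  ∃₂ λ b d → d ⟶ b ∙ c × w ≡ commonWord i j h b c d
derives-unique {c = c} i j h D E
  with leftSpine-run (j + suc h) D
... | _ , _ , b , refl , D₁ , A with rightSpine-run i D₁
... | u , _ , y , refl , R , leaf with run-split j A
... | v , _ , p , refl , A₁ , _∷_ {x = z} {b = p′} p⟶zp′ A₂
  with rightSpine-along R (subst (_ ⊢ c ⇒_) (++-assoc u _ _) E)
... | _ , R′ , node {c = d} σ leaf E₁ refl with rightSpine-along A₁ E₁
... | q , A₁′ , E₂ with leftSpine-run h E₂
... | _ , _ , _ , eq , leaf , A₂′ with eq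
-- The letter `y` ends the run `R` and is also the next leaf of `RightTurn`, so `σ` makes `d` the
-- sum of the end labels of `R` and `R′`. Hence it is the sum of their starts `b` and `c`.
... | refl with difference-backwards (rotate (swap σ)) R R′
... | ρ with runs-alternate ρ R R′
... | refl , refl , refl with c⟶bd ← rotate (swap ρ) with runs-alternate c⟶bd A₁ A₁′
-- In the last stretch both trees ascend: `RightTurn` from its bottom leaf `z`, `LeftTurn` from `p′`
-- just after reading `z`.
... | refl , refl , refl with runs-alternate p⟶zp′ A₂′ A₂
... | refl , q≡ , _ =
  b , d , ρ , trans (++-assoc (replicate i d) _ _)
    (cong (λ x → replicate i d ++ alternate i b c ∷ replicate j c ++ x ∷ replicate h p) z≡)
  where
  -- Both sides complete `p` and `q` to a rule.
  c≡ : c ≡ alternate h p′ z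
  c≡ = child-unique (rotate (alternate-⟶ j c⟶bd))
         (subst (λ x → p ⟶ x ∙ alternate h p′ z) (sym q≡) (alternate-⟶ h p⟶zp′))
  z≡ : z ≡ alternate h (alternate j d b) c
  z≡ = trans (sym (alternate-involutive h z p′))
         (cong₂ (alternate h) (sym q≡) (sym c≡))

-- Counting the classes and matching the parameters

commonWord-∼ : ∀ i j h → d ⟶ b ∙ c →
               commonWord i j h 0F 1F 2F ∼ commonWord i j h b c d
commonWord-∼ i j h ρ with permutationTo ρ
... | π , refl , refl , refl = π , map-commonWord (π ⟨$⟩ʳ_) i j h 0F 1F 2F

parseWords-unique : ∀ i j h → ∣ ParseWords (LeftTurn i j h) (RightTurn i j h) ∣≡ 1
parseWords-unique i j h = record
  { to        = λ _ → 0F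
  ; from      = λ _ → commonWord i j h 0F 1F 2F
                    , derives⇒parses (leftTurn-derives i j h 2⟶01)
                    , derives⇒parses (rightTurn-derives i j h 2⟶01)
  ; to-cong   = λ _ → refl
  ; from-cong = λ _ → ∼-refl
  ; inverse   = (λ { {0F} _ → refl }) , λ { {_ , P , Q} _ → commonWord-∼-parsed P Q }
  }
  where
  commonWord-∼-parsed : LeftTurn i j h parses w → RightTurn i j h parses w →
                        commonWord i j h 0F 1F 2F ∼ w
  commonWord-∼-parsed P Q
    with _ , D ← parses⇒derives P | _ , E ← parses⇒derives Q
    with _ , _ , ρ , refl ← derives-unique i j h D E = commonWord-∼ i j h ρ

leftTurnTree : ∀ i j h → LeftTurnTree (j + suc h) (suc (suc i)) ≡ LeftTurn (suc i) j h
leftTurnTree i j h =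
  trans (pathTree-l (j + suc h) _) (cong (leftSpine (j + suc h)) (pathTree-rs i))

rightTurnTree : ∀ i j h → RightTurnTree (i + suc j) (suc (suc h)) ≡ RightTurn i j (suc h)
rightTurnTree i j h = begin
  pathTree (replicate (i + suc j) r ++ replicate h l)
    ≡⟨ pathTree-r (i + suc j) _ ⟩
  rightSpine (i + suc j) (pathTree (replicate h l))
    ≡⟨ cong (rightSpine (i + suc j)) (pathTree-ls h) ⟩
  rightSpine (i + suc j) (leftSpine (suc h) (leaf tt))
    ≡⟨ rightSpine-+ i (suc j) ⟩
  RightTurn i j (suc h) ∎
  where open ≡-Reasoning

theorem14 : (m k n : ℕ) → 1 ≤ m → 1 ≤ k →
    2 ⊔ ((k + 2) ∸ m) ≤ n → n ≤ k →
    ∣ ParseWords (LeftTurnTree m n) (RightTurnTree k ((m + n) ∸ k)) ∣≡ 1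
theorem14 m k n _ _ lower n≤k
  -- The slacks of the bounds give the stretch lengths: n = 2 + i, k = n + j and m + n = k + 2 + h,
  -- whence m = j + 2 + h. The stretches have lengths i + 1, j and h + 1.
  with i , refl ← m≤n⇒∃[o]m+o≡n (m⊔n≤o⇒m≤o 2 (k + 2 ∸ m) lower)
  with j , refl ← m≤n⇒∃[o]m+o≡n n≤k
  with h , k+2+h≡m+n ← m≤n⇒∃[o]m+o≡n
         (≤-trans (m≤n+m∸n (k + 2) m) (+-monoʳ-≤ m (m⊔n≤o⇒n≤o 2 (k + 2 ∸ m) lower)))
  = subst₂ (λ S T → ∣ ParseWords S T ∣≡ 1) (sym left≡) (sym right≡)
      (parseWords-unique (suc i) j (suc h))
  where
  open ≡-Reasoning
  m≡ : m ≡ j + suc (suc h)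
  m≡ = +-cancelˡ-≡ n _ _ (begin
    n + m                 ≡⟨ +-comm n m ⟩
    m + n                 ≡⟨ k+2+h≡m+n ⟨
    n + j + 2 + h         ≡⟨ +-assoc (n + j) 2 h ⟩
    n + j + (2 + h)       ≡⟨ +-assoc n j (2 + h) ⟩
    n + (j + (2 + h))     ∎)
  q≡ : m + n ∸ k ≡ suc (suc h)
  q≡ = begin
    m + n ∸ k             ≡⟨ cong (_∸ k) k+2+h≡m+n ⟨
    k + 2 + h ∸ k         ≡⟨ cong (_∸ k) (+-assoc k 2 h) ⟩
    k + (2 + h) ∸ k       ≡⟨ m+n∸m≡n k (2 + h) ⟩
    2 + h                 ∎
  left≡ : LeftTurnTree m n ≡ LeftTurn (suc i) j (suc h)
  left≡ = trans (cong (λ m → LeftTurnTree m n) m≡) (leftTurnTree i j (suc h))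
  right≡ : RightTurnTree k (m + n ∸ k) ≡ RightTurn (suc i) j (suc h)
  right≡ = trans (cong₂ RightTurnTree (sym (+-suc (suc i) j)) q≡)
             (rightTurnTree (suc i) j h)
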